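{- For each integer $\delta \geq 2$, there exist infinitely many (pairwise non-isomorphic) graphs $G$ with minimum degree $\delta$ such that, writing $n$ for the order of $G$, $rad_p(G) = n - \delta - 1$.
   Context: All graphs are finite, simple, undirected and non-empty. For a graph $G$ and $S \subseteq V(G)$, define $P^1_G(S) = N[S]$ (the closed neighbourhood of $S$), and for $i \geq 1$ let $V^i = \{v \in P^i_G(S) : |N[v] \setminus P^i_G(S)| \leq 1\}$ and $P^{i+1}_G(S) = P^i_G(S) \cup N[V^i]$. The set $S$ is a power dominating set (PDS) of $G$ if $P^i_G(S) = V(G)$ for some $i \ge 1$. The power domination number $\gamma_p(G)$ is the minimum cardinality of a PDS of $G$. For a PDS $S$, $rad_p(G,S) = \min\{i \geq 1 : P^i_G(S) = V(G)\}$. The propagation radius of $G$ is $rad_p(G) = \min\{rad_p(G,S) : S \text{ is a PDS of } G \text{ with } |S| = \gamma_p(G)\}$. -}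

module Defs where

open import Level using (Level; 0ℓ)
open import Data.Nat using (ℕ; zero; suc; _≤_; _≤?_; NonZero)
open import Data.Fin using (Fin)
open import Data.Fin.Properties using (any?; _≟_)
open import Data.Fin.Subset using (Subset; _∈_; _∪_; _─_; ∣_∣; ⊤)
open import Data.Fin.Subset.Properties using (_∈?_)
open import Data.Product using (Σ; ∃; _×_)
open import Data.Vec using (tabulate)
open import Function.Bundles using (_↔_; _⇔_; Inverse)
open import Relation.Binary using (Rel; Symmetric; Irreflexive)
import Relation.Binary as B
open import Relation.Binary.PropositionalEquality using (_≡_)
open import Relation.Nullary using (does)
open import Relation.Nullary.Decidable using (_⊎-dec_; _×-dec_)
open import Relation.Unary using (Pred)
import Relation.Unary as U

private
  variable
    n : ℕ
    ℓ : Level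

IsLeast : Pred ℕ ℓ → ℕ → Set ℓ
IsLeast P m = P m × (∀ k → P k → m ≤ k)

comprehension : {P : Pred (Fin n) ℓ} → U.Decidable P → Subset n
comprehension P? = tabulate (λ v → does (P? v))

record Graph : Set₁ where
  field
    order       : ℕ
    {{nonEmpty}} : NonZero order
    Adj         : Rel (Fin order) 0ℓ
    adj?        : B.Decidable Adj
    symmetric   : Symmetric Adj
    irreflexive : Irreflexive _≡_ Adj

  Vertex : Set
  Vertex = Fin order

  N⟨_⟩ : Vertex → Subset order
  N⟨ v ⟩ = comprehension (adj? v)

  degree : Vertex → ℕ
  degree v = ∣ N⟨ v ⟩ ∣

  N[_] : Vertex → Subset order
  N[ v ] = comprehension (λ w → (v ≟ w) ⊎-dec adj? v w)

  N[[_]] : Subset order → Subset order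
  N[[ S ]] = comprehension (λ w → any? (λ v → (v ∈? S) ×-dec (w ∈? N[ v ])))

  -- V^i is propagators (P S i).
  propagators : Subset order → Subset order
  propagators X =
    comprehension (λ v → (v ∈? X) ×-dec (∣ N[ v ] ─ X ∣ ≤? 1))

  -- P S i is P^i_G(S). This sequence starts at i = 1; the value at 0 is
  -- a convention, and every use below requires 1 ≤ i.
  P : Subset order → ℕ → Subset order
  P S zero          = S
  P S (suc zero)    = N[[ S ]]
  P S (suc (suc i)) = P S (suc i) ∪ N[[ propagators (P S (suc i)) ]]

  ObservedBy : Subset order → Pred ℕ 0ℓ
  ObservedBy S i = 1 ≤ i × P S i ≡ ⊤

  IsPDS : Pred (Subset order) 0ℓ
  IsPDS S = ∃ λ i → ObservedBy S i

-- Each invariant defined as a minimum is given as the relation "the minimum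
-- exists and equals m", which determines m uniquely.

module _ (G : Graph) where
  open Graph G

  HasMinDegree : ℕ → Set
  HasMinDegree = IsLeast (λ d → ∃ λ v → degree v ≡ d)

  HasPowerDominationNumber : ℕ → Set
  HasPowerDominationNumber =
    IsLeast (λ k → ∃ λ (S : Subset order) → IsPDS S × ∣ S ∣ ≡ k)

  HasRadiusFrom : Subset order → ℕ → Set
  HasRadiusFrom S = IsLeast (ObservedBy S)

  HasPropagationRadius : ℕ → Set
  HasPropagationRadius =
    IsLeast (λ r → ∃ λ (S : Subset order) →
      IsPDS S × HasPowerDominationNumber ∣ S ∣ × HasRadiusFrom S r)

_≅_ : Graph → Graph → Set
G ≅ H = Σ (Graph.Vertex G ↔ Graph.Vertex H) λ f →
  ∀ u v → Graph.Adj G u v ⇔ Graph.Adj H (Inverse.to f u) (Inverse.to f v)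

-- All the graphs have power domination number 1. A pair of twins a, a′ forces
-- every one-vertex power dominating set into their closed neighbourhood, which is
-- designed so that the process started there either stops or moves slowly: once the
-- neighbourhood is observed, it walks one vertex at a time along a path whose
-- vertices are all joined to the same δ − 1 hubs. A hub has at least two unobserved
-- neighbours until the path is almost exhausted, so it never speeds up the
-- walk. Non-observation is certified by a decreasing family of sets A i such
-- that a vertex outside A i with a neighbour in A (i + 1) has two in A i.
module Submission where

open import Defs
open import Data.Bool using (Bool; true; false; T; not; _∨_)
open import Data.Bool.Properties using (T?; T-∨; ∨-comm)
open import Data.Empty using (⊥)
open import Data.Fin using (Fin; zero; suc; toℕ; inject₁; _↑ˡ_; _↑ʳ_; fromℕ; fromℕ<)
open import Data.Fin.Permutation using (↔⇒≡)
open import Data.Fin.Properties using (_≟_; any?; toℕ<n; toℕ-fromℕ; toℕ-fromℕ<; toℕ-inject₁; toℕ-injective; toℕ-↑ˡ; +↔⊎; suc-injective)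
import Data.Fin.Subset as Subset
open import Data.Fin.Subset using (Subset; _∈_; _∉_; _─_; _-_; ∣_∣; ⁅_⁆; Nonempty)
open import Data.Fin.Subset.Properties
open import Data.Nat using (ℕ; zero; suc; _+_; _∸_; _≤_; _<_; z≤n; s≤s; s≤s⁻¹; _≡ᵇ_)
open import Data.Nat.Properties hiding (_≟_) renaming (suc-injective to ℕ-suc-injective)
open import Data.Nat.Tactic.RingSolver using (solve-∀)
open import Data.Product using (∃; ∃₂; _×_; _,_; proj₁; proj₂)
open import Data.Sum using (_⊎_; inj₁; inj₂)
open import Data.Sum.Function.Propositional using (_⊎-↔_)
open import Data.Unit using (tt) renaming (⊤ to Unit)
open import Data.Vec using (_∷_; there)
open import Data.Vec.Properties using (lookup⇒[]=; []=⇒lookup; lookup∘tabulate)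
open import Function using (_∘_; _$_; id; Injective)
open import Function.Bundles using (_↔_; Inverse; Equivalence)
open import Function.Construct.Composition using (_↔-∘_)
open import Function.Construct.Identity using (↔-id)
open import Function.Construct.Symmetry using (↔-sym)
open import Relation.Binary.PropositionalEquality using (_≡_; _≢_; refl; sym; trans; cong; subst)
open import Relation.Nullary using (¬_; does; yes; no; contradiction)
open import Relation.Nullary.Decidable using (dec-true; _⊎-dec_; _×-dec_)
open import Relation.Unary using (Pred)
import Relation.Unary as U

private
  variable
    n d : ℕ

-- Finite subsets: membership in comprehensions and bounds on cardinality.

module _ {ℓ} {P : Pred (Fin n) ℓ} (P? : U.Decidable P) where

  ∈-comprehension⁺ : ∀ {x} → P x → x ∈ comprehension P?
  ∈-comprehension⁺ {x} px =
    lookup⇒[]= x _ (trans (lookup∘tabulate _ x) (dec-true (P? x) px))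

  ∈-comprehension⁻ : ∀ {x} → x ∈ comprehension P? → P x
  ∈-comprehension⁻ {x} x∈ with P? x | trans (sym (lookup∘tabulate (does ∘ P?) x)) ([]=⇒lookup x∈)
  ... | yes px | _ = px

x∈p─q⇒x∉q : ∀ {p q : Subset n} {x} → x ∈ p ─ q → x ∉ q
x∈p─q⇒x∉q {p = _ ∷ _} {_ ∷ _} (there x∈) (there x∈q) = x∈p─q⇒x∉q x∈ x∈q

x∈p-y⇒x≢y : ∀ {p : Subset n} {x y} → x ∈ p - y → x ≢ y
x∈p-y⇒x≢y x∈ refl = x∈p─q⇒x∉q x∈ (x∈⁅x⁆ _)

∣p∣≤1+∣p-x∣ : ∀ (p : Subset n) x → ∣ p ∣ ≤ suc ∣ p - x ∣
∣p∣≤1+∣p-x∣ (true  ∷ p) zero    = s≤s (≤-reflexive (cong ∣_∣ (sym (p─⊥≡p p))))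
∣p∣≤1+∣p-x∣ (false ∷ p) zero    = ≤-trans (n≤1+n _) (s≤s (≤-reflexive (cong ∣_∣ (sym (p─⊥≡p p)))))
∣p∣≤1+∣p-x∣ (true  ∷ p) (suc x) = s≤s (∣p∣≤1+∣p-x∣ p x)
∣p∣≤1+∣p-x∣ (false ∷ p) (suc x) = ∣p∣≤1+∣p-x∣ p x

injective⇒≤∣p∣ : ∀ {p : Subset n} (f : Fin d → Fin n) → Injective _≡_ _≡_ f →
                 (∀ i → f i ∈ p) → d ≤ ∣ p ∣
injective⇒≤∣p∣ {d = zero}  f inj f∈p = z≤n
injective⇒≤∣p∣ {d = suc d} {p = p} f inj f∈p =
  ≤-trans (s≤s (injective⇒≤∣p∣ {p = p - f zero} (f ∘ suc) (suc-injective ∘ inj)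
                  (λ i → x∈p∧x≢y⇒x∈p-y (f∈p (suc i)) (λ eq → contradiction (inj eq) λ ()))))
          (x∈p⇒∣p-x∣<∣p∣ {p = p} (f∈p zero))

covered⇒∣p∣≤ : ∀ {p : Subset n} (f : Fin d → Fin n) →
               (∀ {x} → x ∈ p → ∃ λ i → f i ≡ x) → ∣ p ∣ ≤ d
covered⇒∣p∣≤ {n = n} {d = zero} f cover =
  ≤-reflexive (trans (cong ∣_∣ (Empty-unique (λ (_ , x∈) → contradiction (proj₁ (cover x∈)) λ ())))
                     (∣⊥∣≡0 n))
covered⇒∣p∣≤ {d = suc d} {p = p} f cover =
  ≤-trans (∣p∣≤1+∣p-x∣ p (f zero)) (s≤s (covered⇒∣p∣≤ (f ∘ suc) rest))
  where
  rest : ∀ {x} → x ∈ p - f zero → ∃ λ i → f (suc i) ≡ x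
  rest x∈ with cover (p─q⊆p p _ x∈)
  ... | zero  , eq = contradiction (sym eq) (x∈p-y⇒x≢y x∈)
  ... | suc i , eq = i , eq

∣p∣≤1⇒≡ : ∀ {p : Subset n} {x y} → ∣ p ∣ ≤ 1 → x ∈ p → y ∈ p → x ≡ y
∣p∣≤1⇒≡ {p = p} {x} {y} ∣p∣≤1 x∈ y∈ with x ≟ y
... | yes x≡y = x≡y
... | no  x≢y = contradiction (≤-trans (injective⇒≤∣p∣ pair inj mem) ∣p∣≤1) λ { (s≤s ()) }
  where
  pair : Fin 2 → Fin _
  pair zero    = x
  pair (suc _) = y
  inj : Injective _≡_ _≡_ pair
  inj {zero}     {zero}     _  = refl
  inj {zero}     {suc zero} eq = contradiction eq x≢y
  inj {suc zero} {zero}     eq = contradiction (sym eq) x≢y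
  inj {suc zero} {suc zero} _  = refl
  mem : ∀ i → pair i ∈ p
  mem zero    = x∈
  mem (suc _) = y∈

all-≡⇒∣p∣≤1 : ∀ {p : Subset n} y → (∀ {x} → x ∈ p → y ≡ x) → ∣ p ∣ ≤ 1
all-≡⇒∣p∣≤1 y eq = covered⇒∣p∣≤ (λ (_ : Fin 1) → y) (λ x∈ → zero , eq x∈)

-- Power domination from one vertex: upper and lower bounds on observation times.

module PowerDomination {V : Set} {n : ℕ} (ι : V ↔ Fin (suc n)) (E : V → V → Bool)
         (E-sym : ∀ v w → E v w ≡ E w v) (E-irr : ∀ v → E v v ≡ false) where

  open Inverse ι using (to; from) renaming (strictlyInverseˡ to to∘from; strictlyInverseʳ to from∘to)

  -- Vertices are described in a structured type `V` and adjacency is Boolean, so between concrete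
  -- constructors an edge is proved by `tt` and a non-edge refuted by `()`. The bijection `ι`
  -- transports this to `Fin`.
  graph : Graph
  graph = record
    { order       = suc n
    ; Adj         = λ x y → T (E (from x) (from y))
    ; adj?        = λ x y → T? _
    ; symmetric   = λ {x} {y} → subst T (E-sym (from x) (from y))
    ; irreflexive = λ { {x} refl → subst T (E-irr (from x)) }
    }

  open Graph graph

  infix 4 _~_ _≃_
  _~_ : V → V → Set
  v ~ w = T (E v w)

  _≃_ : V → V → Set
  v ≃ w = v ≡ w ⊎ v ~ w

  from-injective : ∀ {x y} → from x ≡ from y → x ≡ y
  from-injective {x} {y} eq = trans (sym (to∘from x)) (trans (cong to eq) (to∘from y))

  to-injective : ∀ {v w} → to v ≡ to w → v ≡ w
  to-injective {v} {w} eq = trans (sym (from∘to v)) (trans (cong from eq) (from∘to w))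

  -- The numeric label recovers `i` from `f i`, so the distinctness of the listed neighbours costs
  -- one equation per neighbour instead of one comparison per pair.
  degree≥ : ∀ v (f : Fin d → V) (label : V → ℕ) → (∀ i → label (f i) ≡ toℕ i) →
            (∀ i → v ~ f i) → d ≤ degree (to v)
  degree≥ v f label labelled v~f = injective⇒≤∣p∣ (to ∘ f) injective
    (λ i → ∈-comprehension⁺ (adj? (to v)) (adj i))
    where
    injective : Injective _≡_ _≡_ (to ∘ f)
    injective {i} {j} eq = toℕ-injective
      (trans (sym (labelled i)) (trans (cong label (to-injective eq)) (labelled j)))

    adj : ∀ i → T (E (from (to v)) (from (to (f i))))
    adj i rewrite from∘to v | from∘to (f i) = v~f i

  degree≤ : ∀ v (f : Fin d → V) → (∀ {w} → v ~ w → ∃ λ i → f i ≡ w) → degree (to v) ≤ d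
  degree≤ v f cover = covered⇒∣p∣≤ (to ∘ f) λ {x} x∈ →
    let i , eq = cover (subst (_~ from x) (from∘to v) (∈-comprehension⁻ (adj? (to v)) x∈))
    in i , trans (cong to eq) (to∘from x)

  hasMinDegree : ∀ {δ} → (∀ v → δ ≤ degree (to v)) → (∃ λ v → degree (to v) ≤ δ) → HasMinDegree graph δ
  hasMinDegree {δ} lower (v , upper) =
    (to v , ≤-antisym upper (lower v)) ,
    λ { _ (x , refl) → subst (λ y → δ ≤ degree y) (to∘from x) (lower (from x)) }

  private
    closed? : ∀ x → U.Decidable (λ y → x ≡ y ⊎ Adj x y)
    closed? x y = (x ≟ y) ⊎-dec adj? x y

    near? : ∀ X → U.Decidable (λ y → ∃ λ x → x ∈ X × y ∈ N[ x ])
    near? X y = any? (λ x → (x ∈? X) ×-dec (y ∈? N[ x ]))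

    propagates? : ∀ X → U.Decidable (λ x → x ∈ X × ∣ N[ x ] ─ X ∣ ≤ 1)
    propagates? X x = (x ∈? X) ×-dec (∣ N[ x ] ─ X ∣ ≤? 1)

  ∈N[]⁺ : ∀ {x y} → from x ≃ from y → y ∈ N[ x ]
  ∈N[]⁺ (inj₁ eq)  = ∈-comprehension⁺ (closed? _) (inj₁ (from-injective eq))
  ∈N[]⁺ (inj₂ adj) = ∈-comprehension⁺ (closed? _) (inj₂ adj)

  ∈N[]⁻ : ∀ {x y} → y ∈ N[ x ] → from x ≃ from y
  ∈N[]⁻ {x} y∈ with ∈-comprehension⁻ (closed? x) y∈
  ... | inj₁ eq  = inj₁ (cong from eq)
  ... | inj₂ adj = inj₂ adj

  ∈N[[]]⁺ : ∀ {X x y} → x ∈ X → y ∈ N[ x ] → y ∈ N[[ X ]]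
  ∈N[[]]⁺ {x = x} x∈ y∈ = ∈-comprehension⁺ (near? _) (x , x∈ , y∈)

  ∈N[[]]⁻ : ∀ {X y} → y ∈ N[[ X ]] → ∃ λ x → x ∈ X × y ∈ N[ x ]
  ∈N[[]]⁻ {X} = ∈-comprehension⁻ (near? X)

  TwoIn : (V → Set) → V → Set
  TwoIn A v = ∃₂ λ x y → x ≢ y × v ~ x × v ~ y × A x × A y

  -- Vertices in A i are not yet observed at time i + 1.
  record Barrier (A : ℕ → V → Set) : Set where
    field
      shrink : ∀ i v → A (suc i) v → A i v
      step   : ∀ i v w → v ~ w → A (suc i) w → A i v ⊎ TwoIn (A i) v

  module _ {A : ℕ → V → Set} (barrier : Barrier A) {S : Subset order}
           (start : ∀ {x w} → x ∈ S → from x ≃ w → ¬ A 0 w) where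
    open Barrier barrier

    -- A vertex of `A (suc i)` could only be newly observed by a propagating neighbour `v`. Being
    -- observed itself, `v` lies outside `A i`, so the barrier gives it two neighbours in `A i`. By
    -- induction both are unobserved, and `v` may not propagate.
    unobserved : ∀ i {x} → x ∈ P S (suc i) → ¬ A i (from x)
    unobserved zero    x∈ with ∈N[[]]⁻ x∈
    ... | s , s∈ , x∈N = start s∈ (∈N[]⁻ x∈N)
    unobserved (suc i) {x} x∈ ax with x∈p∪q⁻ (P S (suc i)) _ x∈
    ... | inj₁ x∈P = unobserved i x∈P (shrink i _ ax)
    ... | inj₂ x∈N with ∈N[[]]⁻ {propagators (P S (suc i))} x∈N
    ... | v , v∈V , x∈N[v] with ∈-comprehension⁻ (propagates? (P S (suc i))) v∈V
    ... | v∈P , ≤1 with ∈N[]⁻ x∈N[v]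
    ... | inj₁ eq  = unobserved i v∈P (shrink i _ (subst (A (suc i)) (sym eq) ax))
    ... | inj₂ adj with step i _ _ adj ax
    ... | inj₁ av  = unobserved i v∈P av
    ... | inj₂ (y , z , y≢z , v~y , v~z , ay , az) =
      y≢z (to-injective (∣p∣≤1⇒≡ ≤1 (mem v~y ay) (mem v~z az)))
      where
      mem : ∀ {w} → from v ~ w → A i w → to w ∈ N[ v ] ─ P S (suc i)
      mem {w} v~w aw = x∈p∧x∉q⇒x∈p─q
        (∈N[]⁺ (inj₂ (subst (from v ~_) (sym (from∘to w)) v~w)))
        (λ w∈ → unobserved i w∈ (subst (A i) (sym (from∘to w)) aw))

    -- `A k` avoids `P S (suc k)`, so complete observation at time `suc k` forces `A k` to be empty.
    -- This shift by one turns liveness below `r` into a strict bound.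
    unobserved⇒< : ∀ {r k} → (∀ i → i < r → ∃ (A i)) → ObservedBy S k → r < k
    unobserved⇒< {k = suc k} live (_ , eq) = s≤s $ ≮⇒≥ λ k<r →
      let v , av = live k k<r
      in unobserved k (subst (to v ∈_) (sym eq) ∈⊤) (subst (A k) (sym (from∘to v)) av)

  -- Starting from s, the vertices in B i are observed at time i + 1.
  record Observation (s : V) (B : ℕ → V → Set) : Set where
    field
      start : ∀ w → B 0 w → s ≃ w
      step  : ∀ i w → B (suc i) w →
              B i w ⊎ ∃ λ v → B i v × v ~ w × (∀ x → v ~ x → B i x ⊎ x ≡ w)

  module _ {s : V} {B : ℕ → V → Set} (observation : Observation s B) where
    open Observation observation

    -- The vertex `v` supplied by `step` is observed, as is each of its neighbours except possibly
    -- `w`. Hence at most `w` is missing from its closed neighbourhood, and `v` propagates to it.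
    observed : ∀ i {w} → B i w → to w ∈ P ⁅ to s ⁆ (suc i)
    observed zero    {w} b = ∈N[[]]⁺ (x∈⁅x⁆ (to s)) (∈N[]⁺ s≃w)
      where
      s≃w : from (to s) ≃ from (to w)
      s≃w rewrite from∘to s | from∘to w = start w b
    observed (suc i) {w} b with step i w b
    ... | inj₁ b′ = x∈p∪q⁺ (inj₁ (observed i b′))
    ... | inj₂ (v , bv , v~w , rest) = x∈p∪q⁺ (inj₂ (∈N[[]]⁺ propagates (∈N[]⁺ v≃w)))
      where
      v≃w : from (to v) ≃ from (to w)
      v≃w rewrite from∘to v | from∘to w = inj₂ v~w

      only : ∀ {x} → x ∈ N[ to v ] ─ P ⁅ to s ⁆ (suc i) → to w ≡ x
      only {x} x∈ with ∈N[]⁻ (p─q⊆p N[ to v ] _ x∈)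
      ... | inj₁ eq  = contradiction
        (subst (_∈ P ⁅ to s ⁆ (suc i)) (from-injective eq) (observed i bv)) (x∈p─q⇒x∉q x∈)
      ... | inj₂ adj with rest (from x) (subst (_~ from x) (from∘to v) adj)
      ... | inj₁ bx = contradiction
        (subst (_∈ P ⁅ to s ⁆ (suc i)) (to∘from x) (observed i bx)) (x∈p─q⇒x∉q x∈)
      ... | inj₂ eq = trans (cong to (sym eq)) (to∘from x)

      propagates : to v ∈ propagators (P ⁅ to s ⁆ (suc i))
      propagates = ∈-comprehension⁺ (propagates? _) (observed i bv , all-≡⇒∣p∣≤1 (to w) only)

  -- One notion for both ways in which a starting vertex is not too fast: a shrinking barrier shows
  -- that it is slow, a constant one that it never finishes.
  Delayed : ℕ → V → Set₁
  Delayed r s = ∃ λ A → Barrier A × (∀ w → s ≃ w → ¬ A 0 w) × (∀ i → i < r → ∃ (A i))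

  -- With nothing observed at the start, the set of all vertices is a barrier that lives forever.
  -- The bound `r < k` may then be taken at `r = k`, which is absurd.
  empty-unobserved : ∀ {S k} → V → ¬ Nonempty S → ¬ ObservedBy S k
  empty-unobserved {S} {k} v empty observedBy = <-irrefl refl
    (unobserved⇒< {A = λ _ _ → Unit}
      (record { shrink = λ _ _ _ → tt ; step = λ _ _ _ _ _ → inj₁ tt })
      {S} (λ x∈ → contradiction (_ , x∈) empty) (λ _ _ → v , tt) observedBy)

  -- The observation from `s` gives a power dominating set of size 1, and the empty set is none, so
  -- the power domination number is 1. Every competing set is then a single vertex, whose delay
  -- bounds its radius from below.
  hasPropagationRadius : ∀ {r s B} → Observation s B → (∀ v → B r v) → (∀ v → Delayed r v) →
                         HasPropagationRadius graph (suc r)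
  hasPropagationRadius {r} {s} observation all delayed =
    (⁅ to s ⁆ , pds , minimum , observedBy , λ k → slow (≤-reflexive (∣⁅x⁆∣≡1 (to s)))) ,
    λ { k (S , _ , (_ , least) , (observedBy-k , _)) →
        -- Minimality of the size of `S` is compared with the singleton of `s`, giving at most one
        -- element.
        slow (least 1 (⁅ to s ⁆ , pds , ∣⁅x⁆∣≡1 (to s))) observedBy-k }
    where
    observedBy : ObservedBy ⁅ to s ⁆ (suc r)
    observedBy = s≤s z≤n , ⊆-antisym (⊆-max _) λ {x} _ →
      subst (_∈ P ⁅ to s ⁆ (suc r)) (to∘from x) (observed observation r (all (from x)))

    pds : IsPDS ⁅ to s ⁆
    pds = suc r , observedBy

    slow : ∀ {S k} → ∣ S ∣ ≤ 1 → ObservedBy S k → suc r ≤ k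
    slow {S} ≤1 ob with nonempty? S
    ... | no empty     = contradiction ob (empty-unobserved s empty)
    ... | yes (x , x∈) = let A , barrier , start , live = delayed (from x) in
      unobserved⇒< barrier
        (λ {y} {w} y∈ y≃w → start w (subst (_≃ w) (cong from (∣p∣≤1⇒≡ ≤1 y∈ x∈)) y≃w)) live ob

    minimum : HasPowerDominationNumber graph ∣ ⁅ to s ⁆ ∣
    minimum = (⁅ to s ⁆ , pds , refl) , λ { k (S , (j , ob) , refl) →
      subst (_≤ ∣ S ∣) (sym (∣⁅x⁆∣≡1 (to s))) (n≢0⇒n>0 λ S≡0 →
        empty-unobserved s
          (λ (_ , x∈) → contradiction (≤-trans (x∈p⇒∣p-x∣<∣p∣ {p = S} x∈) (≤-reflexive S≡0)) λ ()) ob) }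

  -- A fort is a barrier that never shrinks.
  stuck : ∀ {r s} {F : V → Set} → (∀ v w → v ~ w → F w → F v ⊎ TwoIn F v) →
          (∀ w → s ≃ w → ¬ F w) → ∃ F → Delayed r s
  stuck {F = F} step start nonempty =
    (λ _ → F) , record { shrink = λ _ _ → id ; step = λ _ → step } , start , λ _ _ → nonempty

-- The common construction: a core, hubs and a long path.

pattern core i = inj₁ i
pattern hub j  = inj₂ (inj₁ j)
pattern path x = inj₂ (inj₂ x)

-- A path whose vertices are all joined to d independent hubs, and whose first
-- vertex is joined to the ports of a core. The minimum degree d + 1 is attained at its last vertex.
module PathWithHubs (c d extra : ℕ) (C : Fin (suc c) → Fin (suc c) → Bool)
  (H : Fin (suc c) → Fin d → Bool) (port : Fin (suc c) → Bool)
  (C-sym : ∀ i j → C i j ≡ C j i) (C-irr : ∀ i → C i i ≡ false) where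

  -- The summand `suc d` gives each hub enough path neighbours to reach degree d + 1, and `extra`
  -- makes the family infinite. The leading 3 exposes positions 0, 1 and 2 as constructors.
  m : ℕ
  m = 3 + (suc d + extra)

  V : Set
  V = Fin (suc c) ⊎ Fin d ⊎ Fin m

  next : Fin m → Fin m → Bool
  next x y = suc (toℕ x) ≡ᵇ toℕ y

  attached : Fin (suc c) → Fin m → Bool
  attached i zero    = port i
  attached i (suc _) = false

  E : V → V → Bool
  E (core i) (core j) = C i j
  E (core i) (hub j)  = H i j
  E (core i) (path x) = attached i x
  E (hub j)  (core i) = H i j
  E (hub _)  (hub _)  = false
  E (hub _)  (path _) = true
  E (path x) (core i) = attached i x
  E (path _) (hub _)  = true
  E (path x) (path y) = next x y ∨ next y x

  E-sym : ∀ v w → E v w ≡ E w v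
  E-sym (core i) (core j) = C-sym i j
  E-sym (core _) (hub _)  = refl
  E-sym (core _) (path _) = refl
  E-sym (hub _)  (core _) = refl
  E-sym (hub _)  (hub _)  = refl
  E-sym (hub _)  (path _) = refl
  E-sym (path _) (core _) = refl
  E-sym (path _) (hub _)  = refl
  E-sym (path x) (path y) = ∨-comm (next x y) (next y x)

  E-irr : ∀ v → E v v ≡ false
  E-irr (core i) = C-irr i
  E-irr (hub _)  = refl
  E-irr (path x) = suc≢ (toℕ x)
    where
    suc≢ : ∀ k → (suc k ≡ᵇ k) ∨ (suc k ≡ᵇ k) ≡ false
    suc≢ zero    = refl
    suc≢ (suc k) = suc≢ k

  ι : V ↔ Fin (suc c + (d + m))
  ι = ↔-sym ((↔-id _ ⊎-↔ +↔⊎) ↔-∘ +↔⊎)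

  open PowerDomination ι E E-sym E-irr public

  ~-step : ∀ {x y : Fin m} → suc (toℕ x) ≡ toℕ y → path x ~ path y
  ~-step {x} {y} eq = Equivalence.from T-∨ (inj₁ (≡⇒≡ᵇ (suc (toℕ x)) (toℕ y) eq))

  ~-symmetric : ∀ {v w} → v ~ w → w ~ v
  ~-symmetric {v} {w} = subst T (E-sym v w)

  path-near : ∀ {x y : Fin m} → path x ~ path y → toℕ y ≤ suc (toℕ x)
  path-near {x} {y} adj with Equivalence.to T-∨ adj
  ... | inj₁ t = ≤-reflexive (sym (≡ᵇ⇒≡ (suc (toℕ x)) (toℕ y) t))
  ... | inj₂ t = ≤-trans (n≤1+n _) (≤-trans (≤-reflexive (≡ᵇ⇒≡ (suc (toℕ y)) (toℕ x) t)) (n≤1+n _))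

  -- Blocks every hub in the opening steps, before `Tail` alone describes what is unobserved.
  twoOnPath : ∀ {A : V → Set} j → A (path (suc zero)) → A (path (suc (suc zero))) → TwoIn A (hub j)
  twoOnPath j a₁ a₂ = path (suc zero) , path (suc (suc zero)) , (λ ()) , tt , tt , a₁ , a₂

  Tail : ℕ → V → Set
  Tail c (path x) = c ≤ toℕ x
  Tail c _        = ⊥

  tail-shrink : ∀ c v → Tail (suc c) v → Tail c v
  tail-shrink c (path x) c<x = <⇒≤ c<x

  -- The front moves one position per step. A path vertex next to a position beyond `c` has position
  -- at least `c`. A hub that sees such a position also sees its predecessor, so it has two
  -- neighbours in `Tail c`. Core vertices reach only position 0, which is never beyond `c`.
  tail-step : ∀ c v w → v ~ w → Tail (suc c) w → Tail c v ⊎ TwoIn (Tail c) v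
  tail-step c (hub _)  (path (suc x)) _ (s≤s c≤x) =
    inj₂ (path (suc x) , path (inject₁ x) , (λ eq → 1+n≢n (trans (cong toℕ′ eq) (toℕ-inject₁ x))) , tt , tt ,
          m≤n⇒m≤1+n c≤x , ≤-trans c≤x (≤-reflexive (sym (toℕ-inject₁ x))))
    where
    toℕ′ : V → ℕ
    toℕ′ (path x) = toℕ x
    toℕ′ _        = 0
  tail-step c (path x) (path y) adj c<y = inj₁ (s≤s⁻¹ (≤-trans c<y (path-near {x} {y} adj)))

  tail-live : ∀ {i} → i < m → ∃ (Tail i)
  tail-live i<m = path (fromℕ< i<m) , ≤-reflexive (sym (toℕ-fromℕ< i<m))

  -- By `path-near` the neighbours of position x on the path lie at or before x + 1. With core and
  -- hubs observed, only position x + 1 can be missing.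
  last-to-act : ∀ {B : V → Set} (x : Fin (2 + (suc d + extra))) →
                (∀ i → B (core i)) → (∀ j → B (hub j)) → (∀ y → toℕ y ≤ toℕ x → B (path y)) →
                ∀ v → path (inject₁ x) ~ v → B v ⊎ v ≡ path (suc x)
  last-to-act x cores hubs paths (core i) _ = inj₁ (cores i)
  last-to-act x cores hubs paths (hub j)  _ = inj₁ (hubs j)
  last-to-act x cores hubs paths (path y) adj
    with m≤n⇒m<n∨m≡n (subst (λ k → toℕ y ≤ suc k) (toℕ-inject₁ x) (path-near {inject₁ x} {y} adj))
  ... | inj₁ y<1+x = inj₁ (paths y (s≤s⁻¹ y<1+x))
  ... | inj₂ y≡1+x = inj₂ (cong (inj₂ ∘ inj₂) (toℕ-injective y≡1+x))

  -- The predecessor is preferred because it is the only path neighbour of the last vertex.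
  -- `pathNeighbours` is then the full neighbourhood there, and the same list serves both degree
  -- bounds.
  neighbour : Fin m → Fin m
  neighbour zero    = suc zero
  neighbour (suc x) = inject₁ x

  ~-neighbour : ∀ x → path x ~ path (neighbour x)
  ~-neighbour zero    = tt
  ~-neighbour (suc x) = ~-symmetric {path (inject₁ x)} {path (suc x)} (~-step {inject₁ x} {suc x} (cong suc (toℕ-inject₁ x)))

  pathNeighbours : Fin m → Fin (suc d) → V
  pathNeighbours x zero    = path (neighbour x)
  pathNeighbours x (suc j) = hub j

  degree-path : ∀ x → suc d ≤ Graph.degree graph (Inverse.to ι (path x))
  degree-path x = degree≥ (path x) (pathNeighbours x)
    (λ { (hub j) → suc (toℕ j) ; _ → 0 }) (λ { zero → refl ; (suc _) → refl })
    (λ { zero → ~-neighbour x ; (suc _) → tt })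

  degree-hub : ∀ j → suc d ≤ Graph.degree graph (Inverse.to ι (hub j))
  degree-hub j = degree≥ (hub j) (λ i → path (3 ↑ʳ (i ↑ˡ extra)))
    (λ { (path x) → toℕ x ∸ 3 ; _ → 0 }) (λ i → toℕ-↑ˡ i extra) (λ _ → tt)

  minDegree : (∀ i → suc d ≤ Graph.degree graph (Inverse.to ι (core i))) → HasMinDegree graph (suc d)
  minDegree degree-core = hasMinDegree lower
    (path (suc end) , degree≤ (path (suc end)) (pathNeighbours (suc end)) (λ {w} → cover w))
    where
    end : Fin (2 + (suc d + extra))
    end = fromℕ _

    lower : ∀ v → suc d ≤ Graph.degree graph (Inverse.to ι v)
    lower (core i) = degree-core i
    lower (hub j)  = degree-hub j
    lower (path x) = degree-path x

    cover : ∀ w → path (suc end) ~ w → ∃ λ i → pathNeighbours (suc end) i ≡ w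
    cover (hub j)  _ = suc j , refl
    cover (path y) adj with Equivalence.to T-∨ adj
    -- A successor of the last position would fall outside `Fin m`.
    ... | inj₁ t = contradiction
      (≤-trans (≤-reflexive (cong (2 +_) (sym (toℕ-fromℕ _)))) (≤-trans (≤-reflexive (≡ᵇ⇒≡ (suc (toℕ (suc end))) (toℕ y) t)) (s≤s⁻¹ (toℕ<n y))))
      1+n≰n
    ... | inj₂ t = zero , cong (inj₂ ∘ inj₂)
      (toℕ-injective (trans (toℕ-inject₁ end) (sym (ℕ-suc-injective (≡ᵇ⇒≡ (suc (toℕ y)) (toℕ (suc end)) t)))))

  realisation : ∀ {r s B} → (∀ i → suc d ≤ Graph.degree graph (Inverse.to ι (core i))) →
                Observation s B → (∀ v → B r v) → (∀ v → Delayed r v) →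
                ∃ λ G → Graph.order G ≡ suc c + (d + m) × HasMinDegree G (suc d) × HasPropagationRadius G (suc r)
  realisation degree-core observation all delayed =
    graph , refl , minDegree degree-core , hasPropagationRadius observation all delayed

-- Minimum degree 2 or 3.

positive : Fin 2 → Bool
positive zero    = false
positive (suc _) = true

-- An index in `Fin (toℕ k)` exists only for k = 1. It indexes the third neighbour that a twin then
-- needs, namely the other twin.
Fin[k]⇒positive : ∀ (k : Fin 2) → Fin (toℕ k) → T (positive k)
Fin[k]⇒positive (suc zero) _ = tt

toℕ-Fin[k] : ∀ (k : Fin 2) (x : Fin (toℕ k)) → toℕ x ≡ 0
toℕ-Fin[k] (suc zero) zero = refl

nonpositive-or-Fin[k] : ∀ (k : Fin 2) → T (not (positive k)) ⊎ Fin (toℕ k)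
nonpositive-or-Fin[k] zero       = inj₁ tt
nonpositive-or-Fin[k] (suc zero) = inj₂ zero

positive-contradiction : ∀ {A : Set} b → T b → T (not b) → A
positive-contradiction true _ ()

pattern a  = zero
pattern a′ = suc zero
pattern u  = suc (suc zero)
pattern w  = suc (suc (suc zero))

-- The case δ = 2 + k. The sets {u} and {w} are power dominating; for a and a′ to be
-- stuck when k = 0 they must not be adjacent, while their degree requires it when k = 1.
module SmallDegree (k : Fin 2) (extra : ℕ) where

  C : Fin 4 → Fin 4 → Bool
  C a  a′ = positive k
  C a′ a  = positive k
  C a  u  = true
  C u  a  = true
  C a  w  = true
  C w  a  = true
  C a′ u  = true
  C u  a′ = true
  C a′ w  = true
  C w  a′ = true
  C _  _  = false

  H : Fin 4 → Fin (suc (toℕ k)) → Bool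
  H u (suc _) = true
  H w _       = true
  H _ _       = false

  port : Fin 4 → Bool
  port u = true
  port _ = false

  C-sym : ∀ i j → C i j ≡ C j i
  C-sym a  a  = refl
  C-sym a  a′ = refl
  C-sym a  u  = refl
  C-sym a  w  = refl
  C-sym a′ a  = refl
  C-sym a′ a′ = refl
  C-sym a′ u  = refl
  C-sym a′ w  = refl
  C-sym u  a  = refl
  C-sym u  a′ = refl
  C-sym u  u  = refl
  C-sym u  w  = refl
  C-sym w  a  = refl
  C-sym w  a′ = refl
  C-sym w  u  = refl
  C-sym w  w  = refl

  C-irr : ∀ i → C i i ≡ false
  C-irr a  = refl
  C-irr a′ = refl
  C-irr u  = refl
  C-irr w  = refl

  open PathWithHubs 3 (suc (toℕ k)) extra C H port C-sym C-irr public

  degree-core : ∀ i → 2 + toℕ k ≤ Graph.degree graph (Inverse.to ι (core i))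
  degree-core a = degree≥ (core a) f
    (λ { (core w) → 1 ; (core a′) → 2 ; _ → 0 })
    (λ { zero → refl ; (suc zero) → refl ; (suc (suc x)) → cong (2 +_) (sym (toℕ-Fin[k] k x)) })
    (λ { zero → tt ; (suc zero) → tt ; (suc (suc x)) → Fin[k]⇒positive k x })
    where
    f : Fin (2 + toℕ k) → V
    f zero          = core u
    f (suc zero)    = core w
    f (suc (suc _)) = core a′
  degree-core a′ = degree≥ (core a′) f
    (λ { (core w) → 1 ; (core a) → 2 ; _ → 0 })
    (λ { zero → refl ; (suc zero) → refl ; (suc (suc x)) → cong (2 +_) (sym (toℕ-Fin[k] k x)) })
    (λ { zero → tt ; (suc zero) → tt ; (suc (suc x)) → Fin[k]⇒positive k x })
    where
    f : Fin (2 + toℕ k) → V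
    f zero          = core u
    f (suc zero)    = core w
    f (suc (suc _)) = core a
  degree-core u = ≤-trans (n≤1+n _) (degree≥ (core u) f
    (λ { (core a′) → 1 ; (path _) → 2 ; (hub j) → 2 + toℕ j ; _ → 0 })
    (λ { zero → refl ; (suc zero) → refl ; (suc (suc zero)) → refl ; (suc (suc (suc _))) → refl })
    (λ { zero → tt ; (suc zero) → tt ; (suc (suc zero)) → tt ; (suc (suc (suc _))) → tt }))
    where
    f : Fin (3 + toℕ k) → V
    f zero                = core a
    f (suc zero)          = core a′
    f (suc (suc zero))    = path zero
    f (suc (suc (suc j))) = hub (suc j)
  degree-core w = ≤-trans (n≤1+n _) (degree≥ (core w) f
    (λ { (core a′) → 1 ; (hub j) → 2 + toℕ j ; _ → 0 })
    (λ { zero → refl ; (suc zero) → refl ; (suc (suc _)) → refl })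
    (λ { zero → tt ; (suc zero) → tt ; (suc (suc _)) → tt }))
    where
    f : Fin (3 + toℕ k) → V
    f zero          = core a
    f (suc zero)    = core a′
    f (suc (suc j)) = hub j

  -- The index says which twin was the start, `zero` meaning `a`. The other twin stays hidden only
  -- for k = 0, since for k = 1 it is adjacent to the start.
  Hidden : V → Fin 2 → Set
  Hidden (core a)  (suc _) = T (not (positive k))
  Hidden (core a′) zero    = T (not (positive k))
  Hidden (core _)  _       = ⊥
  Hidden (hub _)   _       = Unit
  Hidden (path _)  _       = Unit

  hidden⇒nonpositive : ∀ i s → Hidden (core i) s → T (not (positive k))
  hidden⇒nonpositive a  (suc _) t = t
  hidden⇒nonpositive a′ zero    t = t

  -- Only `u` and `w` could break in. Besides position 0 for `u` and hub 0 for `w`, each sees a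
  -- second hidden vertex: the other twin for k = 0, hub 1 for k = 1.
  hidden-step : ∀ s v x → v ~ x → Hidden x s → Hidden v s ⊎ TwoIn (λ y → Hidden y s) v
  hidden-step s (core a) (core a′) adj h =
    positive-contradiction (positive k) adj (hidden⇒nonpositive a′ s h)
  hidden-step s (core a) (core u) _ ()
  hidden-step s (core a) (core w) _ ()
  hidden-step s (core a) (path zero) ()
  hidden-step s (core a) (path (suc _)) ()
  hidden-step s (core a′) (core a) adj h =
    positive-contradiction (positive k) adj (hidden⇒nonpositive a s h)
  hidden-step s (core a′) (core u) _ ()
  hidden-step s (core a′) (core w) _ ()
  hidden-step s (core a′) (path zero) ()
  hidden-step s (core a′) (path (suc _)) ()
  hidden-step s (core u) _ _ _ with nonpositive-or-Fin[k] k
  hidden-step zero    (core u) _ _ _ | inj₁ t = inj₂ (core a′ , path zero , (λ ()) , tt , tt , t , tt)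
  hidden-step (suc _) (core u) _ _ _ | inj₁ t = inj₂ (core a  , path zero , (λ ()) , tt , tt , t , tt)
  hidden-step s       (core u) _ _ _ | inj₂ j = inj₂ (hub (suc j) , path zero , (λ ()) , tt , tt , tt , tt)
  hidden-step s (core w) _ _ _ with nonpositive-or-Fin[k] k
  hidden-step zero    (core w) _ _ _ | inj₁ t = inj₂ (core a′ , hub zero , (λ ()) , tt , tt , t , tt)
  hidden-step (suc _) (core w) _ _ _ | inj₁ t = inj₂ (core a  , hub zero , (λ ()) , tt , tt , t , tt)
  hidden-step s       (core w) _ _ _ | inj₂ j = inj₂ (hub (suc j) , hub zero , (λ ()) , tt , tt , tt , tt)
  hidden-step s (hub _)  _ _ _ = inj₁ tt
  hidden-step s (path _) _ _ _ = inj₁ tt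

  Twins : V → Set
  Twins (core a)  = Unit
  Twins (core a′) = Unit
  Twins _         = ⊥

  -- Outside the pair, a neighbour of one twin is a neighbour of both. Here hubs and path vertices
  -- are adjacent to neither.
  twins-step : ∀ v x → v ~ x → Twins x → Twins v ⊎ TwoIn Twins v
  twins-step (core a)  _ _ _ = inj₁ tt
  twins-step (core a′) _ _ _ = inj₁ tt
  twins-step (core u)  _ _ _ = inj₂ (core a , core a′ , (λ ()) , tt , tt , tt , tt)
  twins-step (core w)  _ _ _ = inj₂ (core a , core a′ , (λ ()) , tt , tt , tt , tt)
  twins-step (path zero)    (core a)  ()
  twins-step (path zero)    (core a′) ()
  twins-step (path (suc _)) (core a)  ()
  twins-step (path (suc _)) (core a′) ()

  -- Two steps pass before the walk starts: `w` is missing at time 1 and hub 0 still at time 2. From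
  -- index 2 on only a tail of the path remains.
  LateFromU : ℕ → V → Set
  LateFromU (suc (suc i)) v  = Tail (suc i) v
  LateFromU _      (path x)  = 1 ≤ toℕ x
  LateFromU _      (hub zero) = Unit
  LateFromU zero   (core w)  = Unit
  LateFromU _      _         = ⊥

  lateFromU : Barrier LateFromU
  lateFromU = record { shrink = shrink ; step = step }
    where
    shrink : ∀ i v → LateFromU (suc i) v → LateFromU i v
    shrink (suc (suc i)) v t = tail-shrink (suc i) v t
    shrink (suc zero) (path x) t = t
    shrink zero (path x) t = t
    shrink zero (hub zero) t = tt

    step : ∀ i v x → v ~ x → LateFromU (suc i) x → LateFromU i v ⊎ TwoIn (LateFromU i) v
    step (suc (suc i)) v x adj t = tail-step (suc i) v x adj t
    step zero (core w)  _ _ _ = inj₁ tt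
    step zero (hub j)  _ _ _ = inj₂ (twoOnPath {LateFromU 0} j (s≤s z≤n) (s≤s z≤n))
    -- The first path vertex is observed at once but cannot advance while hub 0, which is not
    -- adjacent to `u`, is also missing.
    step zero (path zero)  _ _ _ = inj₂ (hub zero , path (suc zero) , (λ ()) , tt , tt , tt , s≤s z≤n)
    step zero (path (suc _)) _ _ _ = inj₁ (s≤s z≤n)
    step zero (core a) (path (suc _)) ()
    step zero (core a′) (path (suc _)) ()
    step zero (core u) (path (suc _)) ()
    step zero (core a) (hub zero) ()
    step zero (core a′) (hub zero) ()
    step zero (core u) (hub zero) ()
    step (suc zero) (hub j) _ _ _ = inj₂ (twoOnPath {LateFromU 1} j (s≤s z≤n) (s≤s z≤n))
    step (suc zero) (path zero)  _ _ _ = inj₂ (hub zero , path (suc zero) , (λ ()) , tt , tt , tt , s≤s z≤n)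
    step (suc zero) (path (suc _)) _ _ _ = inj₁ (s≤s z≤n)
    step (suc zero) (core _) (path (suc _)) ()

  -- From `w` all hubs are observed immediately, but `u` is missing at time 1 and must be observed
  -- before it can start the path at position 0. The resulting bound is the same as from `u`.
  LateFromW : ℕ → V → Set
  LateFromW (suc i) v        = Tail i v
  LateFromW zero    (core u) = Unit
  LateFromW zero    (path _) = Unit
  LateFromW zero    _        = ⊥

  lateFromW : Barrier LateFromW
  lateFromW = record { shrink = shrink ; step = step }
    where
    shrink : ∀ i v → LateFromW (suc i) v → LateFromW i v
    shrink (suc i) v t = tail-shrink i v t
    shrink zero (path x) t = tt

    step : ∀ i v x → v ~ x → LateFromW (suc i) x → LateFromW i v ⊎ TwoIn (LateFromW i) v
    step (suc i) v x adj t = tail-step i v x adj t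
    step zero (core u) _ _ _ = inj₁ tt
    step zero (path _) _ _ _ = inj₁ tt
    step zero (hub j)  _ _ _ = inj₂ (twoOnPath {LateFromW 0} j tt tt)
    step zero (core a)  (path zero)    ()
    step zero (core a)  (path (suc _)) ()
    step zero (core a′) (path zero)    ()
    step zero (core a′) (path (suc _)) ()
    step zero (core w)  (path zero)    ()
    step zero (core w)  (path (suc _)) ()

  delayed : ∀ s → Delayed (suc m) s
  delayed (core a) = stuck (hidden-step zero) start (hub zero , tt)
    where
    start : ∀ x → core a ≃ x → ¬ Hidden x zero
    start (core a′)      (inj₂ adj) t  = positive-contradiction (positive k) adj t
    start (hub _)        (inj₂ ())
    start (path zero)    (inj₂ ())
    start (path (suc _)) (inj₂ ())
  delayed (core a′) = stuck (hidden-step (suc zero)) start (hub zero , tt)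
    where
    start : ∀ x → core a′ ≃ x → ¬ Hidden x (suc zero)
    start (core a′)      _ ()
    start (core u)       _ ()
    start (core w)       _ ()
    start (core a)       (inj₂ adj) t  = positive-contradiction (positive k) adj t
    start (hub _)        (inj₂ ())
    start (path zero)    (inj₂ ())
    start (path (suc _)) (inj₂ ())
  delayed (core u) = LateFromU , lateFromU , start , live
    where
    start : ∀ x → core u ≃ x → ¬ LateFromU 0 x
    start (core a)       _ ()
    start (core a′)      _ ()
    start (core u)       _ ()
    start (core w)       (inj₂ ())
    start (hub zero)     (inj₂ ())
    start (path zero)    _ ()
    start (path (suc _)) (inj₂ ())

    live : ∀ i → i < suc m → ∃ (LateFromU i)
    live zero          _         = core w , tt
    live (suc zero)    _         = hub zero , tt
    live (suc (suc i)) (s≤s i<m) = tail-live i<m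
  delayed (core w) = LateFromW , lateFromW , start , live
    where
    start : ∀ x → core w ≃ x → ¬ LateFromW 0 x
    start (core a)       _ ()
    start (core a′)      _ ()
    start (core u)       (inj₂ ())
    start (core w)       _ ()
    start (path zero)    (inj₂ ())
    start (path (suc _)) (inj₂ ())

    live : ∀ i → i < suc m → ∃ (LateFromW i)
    live zero    _         = core u , tt
    live (suc i) (s≤s i<m) = tail-live i<m
  delayed (hub j) = stuck twins-step start (core a , tt)
    where
    start : ∀ x → hub j ≃ x → ¬ Twins x
    start (core a)  (inj₂ ())
    start (core a′) (inj₂ ())
  delayed (path y) = stuck twins-step (start y) (core a , tt)
    where
    start : ∀ y x → path y ≃ x → ¬ Twins x
    start zero    (core a)  (inj₂ ())
    start zero    (core a′) (inj₂ ())
    start (suc _) (core a)  (inj₂ ())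
    start (suc _) (core a′) (inj₂ ())

  -- The complement of `LateFromU i` at each index, so the two bounds meet. The truncated `i ∸ 2`
  -- keeps the walk at position 0 for the indices 0, 1 and 2.
  Early : ℕ → V → Set
  Early i       (path x)   = toℕ x < suc (i ∸ 2)
  Early zero    (core w)   = ⊥
  Early zero    (hub zero) = ⊥
  Early (suc zero) (hub zero) = ⊥
  Early _       _          = Unit

  early-core : ∀ i j → Early (suc i) (core j)
  early-core i a = tt
  early-core i a′ = tt
  early-core i u = tt
  early-core i w = tt

  observation : Observation (core u) Early
  observation = record { start = start ; step = step }
    where
    start : ∀ x → Early 0 x → core u ≃ x
    start (core a)  _ = inj₂ tt
    start (core a′) _ = inj₂ tt
    start (core u)  _ = inj₁ refl
    start (core w)  ()
    start (hub (suc _)) _ = inj₂ tt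
    start (path zero) _ = inj₂ tt
    start (path (suc _)) (s≤s ())

    fromA : ∀ x → core a ~ x → Early 0 x ⊎ x ≡ core w
    fromA (core a′) _ = inj₁ tt
    fromA (core u)  _ = inj₁ tt
    fromA (core w)  _ = inj₂ refl
    fromA (path zero) ()
    fromA (path (suc _)) ()

    fromW : ∀ x → core w ~ x → Early 1 x ⊎ x ≡ hub zero
    fromW (core i)  _ = inj₁ (early-core 0 i)
    fromW (hub zero) _ = inj₂ refl
    fromW (hub (suc _)) _ = inj₁ tt
    fromW (path zero) ()
    fromW (path (suc _)) ()

    step : ∀ i x → Early (suc i) x →
           Early i x ⊎ ∃ λ v → Early i v × v ~ x × (∀ y → v ~ y → Early i y ⊎ y ≡ x)
    step zero    (core a)  _ = inj₁ tt
    step zero    (core a′) _ = inj₁ tt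
    step zero    (core u)  _ = inj₁ tt
    -- The forcing chain is `a` to `w`, then `w` to hub 0, and only then along the path.
    step zero    (core w)  _ = inj₂ (core a , tt , tt , fromA)
    step (suc i) (core j)  _ = inj₁ (early-core i j)
    step zero    (hub (suc _)) _ = inj₁ tt
    step (suc zero) (hub (suc _)) _ = inj₁ tt
    step (suc (suc _)) (hub (suc _)) _ = inj₁ tt
    step (suc zero) (hub zero) _ = inj₂ (core w , tt , tt , fromW)
    step (suc (suc _)) (hub zero) _ = inj₁ tt
    step zero       (path x) b = inj₁ b
    step (suc zero) (path x) b = inj₁ b
    step (suc (suc i)) (path zero) _ = inj₁ (s≤s z≤n)
    step (suc (suc i)) (path (suc x)) (s≤s x<1+i) = inj₂
      (path (inject₁ x) , subst (_< suc i) (sym (toℕ-inject₁ x)) x<1+i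
      , ~-step {inject₁ x} {suc x} (cong suc (toℕ-inject₁ x))
      , last-to-act {Early (2 + i)} x (early-core (suc i)) (λ { zero → tt ; (suc _) → tt })
          (λ y y≤x → ≤-trans (s≤s y≤x) x<1+i))

  witness : ∃ λ G → Graph.order G ≡ 4 + (suc (toℕ k) + m) × HasMinDegree G (2 + toℕ k) ×
                    HasPropagationRadius G (2 + m)
  witness = realisation {suc m} {core u} {Early} degree-core observation all delayed
    where
    all : ∀ v → Early (suc m) v
    all (core i)      = early-core m i
    all (hub zero)    = tt
    all (hub (suc _)) = tt
    all (path x)      = toℕ<n x

-- Minimum degree at least 4.

-- The case δ = 4 + e. Missing hub₀ and hub₁ makes u stuck and makes these two hubs
-- twins, so that no other hub is power dominating; hub₀ and hub₁ themselves need
-- a third hub (hence δ ≥ 4) to be stuck. Only {a} and {a′} are power dominating.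
module LargeDegree (e extra : ℕ) where

  C : Fin 3 → Fin 3 → Bool
  C a  a  = false
  C a′ a′ = false
  C u  u  = false
  C _  _  = true

  H : Fin 3 → Fin (3 + e) → Bool
  H u zero       = false
  H u (suc zero) = false
  H _ _          = true

  port : Fin 3 → Bool
  port u = true
  port _ = false

  C-sym : ∀ i j → C i j ≡ C j i
  C-sym a  a  = refl
  C-sym a  a′ = refl
  C-sym a  u  = refl
  C-sym a′ a  = refl
  C-sym a′ a′ = refl
  C-sym a′ u  = refl
  C-sym u  a  = refl
  C-sym u  a′ = refl
  C-sym u  u  = refl

  C-irr : ∀ i → C i i ≡ false
  C-irr a  = refl
  C-irr a′ = refl
  C-irr u  = refl

  open PathWithHubs 2 (3 + e) extra C H port C-sym C-irr public

  hub₀ hub₁ hub₂ : V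
  hub₀ = hub zero
  hub₁ = hub (suc zero)
  hub₂ = hub (suc (suc zero))

  degree-core : ∀ i → 4 + e ≤ Graph.degree graph (Inverse.to ι (core i))
  degree-core a = degree≥ (core a) f
    (λ { (hub j) → suc (toℕ j) ; _ → 0 })
    (λ { zero → refl ; (suc _) → refl }) (λ { zero → tt ; (suc _) → tt })
    where
    f : Fin (4 + e) → V
    f zero    = core a′
    f (suc j) = hub j
  degree-core a′ = degree≥ (core a′) f
    (λ { (hub j) → suc (toℕ j) ; _ → 0 })
    (λ { zero → refl ; (suc _) → refl }) (λ { zero → tt ; (suc _) → tt })
    where
    f : Fin (4 + e) → V
    f zero    = core a
    f (suc j) = hub j
  degree-core u = degree≥ (core u) f
    (λ { (core a′) → 1 ; (path _) → 2 ; (hub j) → suc (toℕ j) ; _ → 0 })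
    (λ { zero → refl ; (suc zero) → refl ; (suc (suc zero)) → refl ; (suc (suc (suc _))) → refl })
    (λ { zero → tt ; (suc zero) → tt ; (suc (suc zero)) → tt ; (suc (suc (suc _))) → tt })
    where
    f : Fin (4 + e) → V
    f zero                = core a
    f (suc zero)          = core a′
    f (suc (suc zero))    = path zero
    f (suc (suc (suc j))) = hub (suc (suc j))

  tail : Barrier Tail
  tail = record { shrink = tail-shrink ; step = tail-step }

  AwayFromU : V → Set
  AwayFromU (hub zero)       = Unit
  AwayFromU (hub (suc zero)) = Unit
  AwayFromU (path (suc _))   = Unit
  AwayFromU _                = ⊥

  -- `AwayFromU` is the complement of the closed neighbourhood of `u`. Apart from `u`, which sees
  -- none of it, each vertex sees either the two hubs that `u` misses or two later path vertices.
  away-step : ∀ v x → v ~ x → AwayFromU x → AwayFromU v ⊎ TwoIn AwayFromU v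
  away-step (core a)  _ _ _ = inj₂ (hub₀ , hub₁ , (λ ()) , tt , tt , tt , tt)
  away-step (core a′) _ _ _ = inj₂ (hub₀ , hub₁ , (λ ()) , tt , tt , tt , tt)
  away-step (core u) (hub zero) ()
  away-step (core u) (hub (suc zero)) ()
  away-step (core u) (path (suc _)) ()
  away-step (hub j)  _ _ _ = inj₂ (twoOnPath {AwayFromU} j tt tt)
  away-step (path _) _ _ _ = inj₂ (hub₀ , hub₁ , (λ ()) , tt , tt , tt , tt)

  -- The complement of the closed neighbourhood of hub 0. Every observed vertex other than hub 0
  -- itself sees both hub 1 and hub 2; this is where the third hub enters.
  OtherThan₀ : V → Set
  OtherThan₀ (core u)      = Unit
  OtherThan₀ (hub (suc _)) = Unit
  OtherThan₀ _             = ⊥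

  other₀-step : ∀ v x → v ~ x → OtherThan₀ x → OtherThan₀ v ⊎ TwoIn OtherThan₀ v
  other₀-step (core a)  _ _ _ = inj₂ (hub₁ , hub₂ , (λ ()) , tt , tt , tt , tt)
  other₀-step (core a′) _ _ _ = inj₂ (hub₁ , hub₂ , (λ ()) , tt , tt , tt , tt)
  other₀-step (core u)  _ _ _ = inj₁ tt
  other₀-step (hub zero) (core u) ()
  other₀-step (hub zero) (hub (suc _)) ()
  other₀-step (hub (suc _)) _ _ _ = inj₁ tt
  other₀-step (path _)  _ _ _ = inj₂ (hub₁ , hub₂ , (λ ()) , tt , tt , tt , tt)

  OtherThan₁ : V → Set
  OtherThan₁ (core u)            = Unit
  OtherThan₁ (hub zero)          = Unit
  OtherThan₁ (hub (suc (suc _))) = Unit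
  OtherThan₁ _                   = ⊥

  other₁-step : ∀ v x → v ~ x → OtherThan₁ x → OtherThan₁ v ⊎ TwoIn OtherThan₁ v
  other₁-step (core a)  _ _ _ = inj₂ (hub₀ , hub₂ , (λ ()) , tt , tt , tt , tt)
  other₁-step (core a′) _ _ _ = inj₂ (hub₀ , hub₂ , (λ ()) , tt , tt , tt , tt)
  other₁-step (core u)  _ _ _ = inj₁ tt
  other₁-step (hub zero) _ _ _ = inj₁ tt
  other₁-step (hub (suc zero)) (core u) ()
  other₁-step (hub (suc zero)) (hub zero) ()
  other₁-step (hub (suc zero)) (hub (suc (suc _))) ()
  other₁-step (hub (suc (suc _))) _ _ _ = inj₁ tt
  other₁-step (path _)  _ _ _ = inj₂ (hub₀ , hub₂ , (λ ()) , tt , tt , tt , tt)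

  TwinHubs : V → Set
  TwinHubs (hub zero)       = Unit
  TwinHubs (hub (suc zero)) = Unit
  TwinHubs _                = ⊥

  -- Hubs 0 and 1 have identical neighbourhoods, and no other hub is adjacent to them.
  twinHubs-step : ∀ v x → v ~ x → TwinHubs x → TwinHubs v ⊎ TwoIn TwinHubs v
  twinHubs-step (core a)  _ _ _ = inj₂ (hub₀ , hub₁ , (λ ()) , tt , tt , tt , tt)
  twinHubs-step (core a′) _ _ _ = inj₂ (hub₀ , hub₁ , (λ ()) , tt , tt , tt , tt)
  twinHubs-step (core u) (hub zero) ()
  twinHubs-step (core u) (hub (suc zero)) ()
  twinHubs-step (hub zero)       _ _ _ = inj₁ tt
  twinHubs-step (hub (suc zero)) _ _ _ = inj₁ tt
  twinHubs-step (hub (suc (suc _))) (hub zero) ()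
  twinHubs-step (hub (suc (suc _))) (hub (suc zero)) ()
  twinHubs-step (path _)  _ _ _ = inj₂ (hub₀ , hub₁ , (λ ()) , tt , tt , tt , tt)

  Twins : V → Set
  Twins (core a)  = Unit
  Twins (core a′) = Unit
  Twins _         = ⊥

  twins-step : ∀ v x → v ~ x → Twins x → Twins v ⊎ TwoIn Twins v
  twins-step (core a)  _ _ _ = inj₁ tt
  twins-step (core a′) _ _ _ = inj₁ tt
  twins-step (core u)  _ _ _ = inj₂ (core a , core a′ , (λ ()) , tt , tt , tt , tt)
  twins-step (hub _)   _ _ _ = inj₂ (core a , core a′ , (λ ()) , tt , tt , tt , tt)
  twins-step (path zero)    (core a)  ()
  twins-step (path zero)    (core a′) ()
  twins-step (path (suc _)) (core a)  ()
  twins-step (path (suc _)) (core a′) ()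

  delayed : ∀ s → Delayed m s
  delayed (core a) = Tail , tail , start , λ _ → tail-live
    where
    start : ∀ x → core a ≃ x → ¬ Tail 0 x
    start (path zero)    (inj₂ ())
    start (path (suc _)) (inj₂ ())
  delayed (core a′) = Tail , tail , start , λ _ → tail-live
    where
    start : ∀ x → core a′ ≃ x → ¬ Tail 0 x
    start (path zero)    (inj₂ ())
    start (path (suc _)) (inj₂ ())
  delayed (core u) = stuck away-step start (hub₀ , tt)
    where
    start : ∀ x → core u ≃ x → ¬ AwayFromU x
    start (hub zero)       (inj₂ ())
    start (hub (suc zero)) (inj₂ ())
    start (path (suc _))   (inj₂ ())
  delayed (hub zero) = stuck other₀-step start (hub₁ , tt)
    where
    start : ∀ x → hub₀ ≃ x → ¬ OtherThan₀ x
    start (core u)      (inj₂ ())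
    start (hub (suc _)) (inj₂ ())
  delayed (hub (suc zero)) = stuck other₁-step start (hub₀ , tt)
    where
    start : ∀ x → hub₁ ≃ x → ¬ OtherThan₁ x
    start (core u)            (inj₂ ())
    start (hub zero)          (inj₂ ())
    start (hub (suc (suc _))) (inj₂ ())
  delayed (hub (suc (suc j))) = stuck twinHubs-step start (hub₀ , tt)
    where
    start : ∀ x → hub (suc (suc j)) ≃ x → ¬ TwinHubs x
    start (hub zero)       (inj₂ ())
    start (hub (suc zero)) (inj₂ ())
  delayed (path y) = stuck twins-step (start y) (core a , tt)
    where
    start : ∀ y x → path y ≃ x → ¬ Twins x
    start zero    (core a)  (inj₂ ())
    start zero    (core a′) (inj₂ ())
    start (suc _) (core a)  (inj₂ ())
    start (suc _) (core a′) (inj₂ ())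

  -- The complement of `Tail i`. There is no initial delay here: from `a` the whole core and all
  -- hubs are observed at time 1, so `u` forces position 0 at time 2.
  Early : ℕ → V → Set
  Early i (path x) = toℕ x < i
  Early _ _        = Unit

  observation : Observation (core a) Early
  observation = record { start = start ; step = step }
    where
    start : ∀ x → Early 0 x → core a ≃ x
    start (core a)  _ = inj₁ refl
    start (core a′) _ = inj₂ tt
    start (core u)  _ = inj₂ tt
    start (hub _)   _ = inj₂ tt
    start (path _)  ()

    fromU : ∀ i x → core u ~ x → Early i x ⊎ x ≡ path zero
    fromU i (core _)  _   = inj₁ tt
    fromU i (hub _)   _   = inj₁ tt
    fromU i (path zero) _ = inj₂ refl

    step : ∀ i x → Early (suc i) x →
           Early i x ⊎ ∃ λ v → Early i v × v ~ x × (∀ y → v ~ y → Early i y ⊎ y ≡ x)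
    step i (core _)  _ = inj₁ tt
    step i (hub _)   _ = inj₁ tt
    step i (path zero) _ = inj₂ (core u , tt , tt , fromU i)
    step i (path (suc x)) (s≤s x<i) = inj₂
      (path (inject₁ x) , subst (_< i) (sym (toℕ-inject₁ x)) x<i
      , ~-step {inject₁ x} {suc x} (cong suc (toℕ-inject₁ x))
      , last-to-act {Early i} x (λ _ → tt) (λ _ → tt) (λ y y≤x → ≤-trans (s≤s y≤x) x<i))

  witness : ∃ λ G → Graph.order G ≡ 3 + ((3 + e) + m) × HasMinDegree G (4 + e) ×
                    HasPropagationRadius G (suc m)
  witness = realisation {m} {core a} {Early} degree-core observation all delayed
    where
    all : ∀ v → Early m v
    all (core _) = tt
    all (hub _)  = tt
    all (path x) = toℕ<n x

-- Assembling infinitely many graphs for each minimum degree.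

Extremal : ℕ → ℕ → Set₁
Extremal δ n = ∃ λ G → Graph.order G ≡ n × HasMinDegree G δ ×
                       HasPropagationRadius G (Graph.order G ∸ δ ∸ 1)

-- The form `δ + suc r` of the order makes the truncated subtractions exact. The second form `n′` is
-- for the caller, who writes the order as a base plus the family index.
extremal : ∀ {δ n n′ r} → n ≡ δ + suc r → n ≡ n′ →
           (∃ λ G → Graph.order G ≡ n × HasMinDegree G δ × HasPropagationRadius G r) → Extremal δ n′
extremal {δ} {r = r} n≡δ+1+r n≡n′ (G , order≡n , minDegree , radius) =
  G , trans order≡n n≡n′ , minDegree , subst (HasPropagationRadius G) (sym r≡) radius
  where
  r≡ : Graph.order G ∸ δ ∸ 1 ≡ r
  r≡ = trans (cong (λ n → n ∸ δ ∸ 1) (trans order≡n n≡δ+1+r)) (cong (_∸ 1) (m+n∸m≡n δ (suc r)))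

extremalSmall : ∀ (k : Fin 2) → ∃ λ N → ∀ i → Extremal (2 + toℕ k) (N + i)
-- The base is solved from `order`: it is 10 + 2k.
extremalSmall k = _ , λ i →
  extremal (excess (toℕ k) _) (order (toℕ k) i) (SmallDegree.witness k i)
  where
  excess : ∀ k m → 4 + (suc k + m) ≡ (2 + k) + suc (2 + m)
  excess = solve-∀
  order : ∀ k i → 4 + (suc k + (3 + (2 + k + i))) ≡ (10 + k + k) + i
  order = solve-∀

extremalLarge : ∀ e → ∃ λ N → ∀ i → Extremal (4 + e) (N + i)
-- Likewise the base is 13 + 2e.
extremalLarge e = _ , λ i →
  extremal (excess e _) (order e i) (LargeDegree.witness e i)
  where
  excess : ∀ e m → 3 + ((3 + e) + m) ≡ (4 + e) + suc (suc m)
  excess = solve-∀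
  order : ∀ e i → 3 + ((3 + e) + (3 + (4 + e + i))) ≡ (13 + e + e) + i
  order = solve-∀

extremalFamily : ∀ δ → 2 ≤ δ → ∃ λ N → ∀ i → Extremal δ (N + i)
extremalFamily 2 _ = extremalSmall zero
extremalFamily 3 _ = extremalSmall (suc zero)
extremalFamily (suc (suc (suc (suc e)))) _ = extremalLarge e
extremalFamily 1 (s≤s ())

theorem3p5 : ∀ (δ : ℕ) → 2 ≤ δ →
    ∃ λ (G : ℕ → Graph) →
      (∀ i j → i ≢ j → ¬ (G i ≅ G j)) ×
      (∀ i → HasMinDegree (G i) δ ×
             HasPropagationRadius (G i) (Graph.order (G i) ∸ δ ∸ 1))
theorem3p5 δ 2≤δ with extremalFamily δ 2≤δ
... | N , family =
  (λ i → proj₁ (family i)) ,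
  -- An isomorphism forces equal orders, and the orders `N + i` are distinct for distinct indices.
  (λ i j i≢j (f , _) → i≢j (+-cancelˡ-≡ N i j (trans (sym (order i)) (trans (↔⇒≡ f) (order j))))) ,
  (λ i → proj₂ (proj₂ (family i)))
  where
  order : ∀ i → Graph.order (proj₁ (family i)) ≡ N + i
  order i = proj₁ (proj₂ (family i))
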